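{- Let $q$ be a prime power, $n\ge 2$, and $m,d\ge 1$ integers. Every $(m,d)$-Hyper-Furstenberg set $S\subseteq\mathbb{F}_q^n$ satisfies $$|S|\ge C_{n,d}\, m^{n/(n-1)},\qquad\text{where } C_{n,d}=\big(16\, d^{n/(n-1)}\big)^{ -1}.$$
   Context: $\mathbb{F}_q$ is the finite field with $q$ elements. A hypersurface $\{x: f(x)=0\}$ for $f\in\mathbb{F}_q[x_1,\dots,x_n]$ is called $(S,m)$-rich if it contains at least $m$ points of $S$. A set $S\subseteq\mathbb{F}_q^n$ is called $(m,d)$-Hyper-Furstenberg if for every linear form $h(x)=h_1x_1+\dots+h_nx_n$ with $h_i\in\mathbb{F}_q$ there exists a polynomial $g\in\mathbb{F}_q[x_1,\dots,x_n]$ of degree at most $d-1$ such that the zero set of $h^d+g$ contains at least $m$ points of $S$. -}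

module Defs where

open import Data.Nat using (ℕ; zero; suc; _≤_; _∸_)
import Data.Nat
open import Data.Fin using (Fin)
open import Data.Vec using (Vec; []; _∷_; zipWith; foldr)
open import Data.List using (List; length; filter)
open import Data.List.Relation.Unary.All using (All)
open import Data.List.Relation.Unary.Unique.Propositional using (Unique)
open import Data.Product using (_×_; _,_; proj₁; proj₂; ∃)
open import Relation.Binary.PropositionalEquality using (_≡_; _≢_)
open import Relation.Binary.Definitions using (DecidableEquality)
open import Algebra.Structures using (IsCommutativeRing)
open import Function.Bundles using (_↔_)

record FiniteField (q : ℕ) : Set₁ where
  field
    Carrier : Set
    _+_ _*_ : Carrier → Carrier → Carrier
    -_ : Carrier → Carrier
    0# 1# : Carrier
    isCommutativeRing : IsCommutativeRing _≡_ _+_ _*_ -_ 0# 1#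
    0≢1 : 0# ≢ 1#
    inverse : ∀ x → x ≢ 0# → ∃ λ y → x * y ≡ 1#
    _≟_ : DecidableEquality Carrier
    enumeration : Fin q ↔ Carrier

  infixl 6 _+_
  infixl 7 _*_

  pow : Carrier → ℕ → Carrier
  pow x zero = 1#
  pow x (suc k) = x * pow x k

  Point : ℕ → Set
  Point n = Vec Carrier n

  monomial : ∀ {n} → Vec ℕ n → Point n → Carrier
  monomial es xs = foldr _ _*_ 1# (zipWith pow xs es)

  totalDegree : ∀ {n} → Vec ℕ n → ℕ
  totalDegree es = foldr _ Data.Nat._+_ 0 es

  -- A polynomial in F_q[x₁,…,xₙ]: a finite list of terms (exponent vector, coefficient)
  Poly : ℕ → Set
  Poly n = List (Vec ℕ n × Carrier)

  eval : ∀ {n} → Poly n → Point n → Carrier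
  eval Data.List.[] x = 0#
  eval (t Data.List.∷ ts) x = proj₂ t * monomial (proj₁ t) x + eval ts x

  DegreeAtMost : ∀ {n} → ℕ → Poly n → Set
  DegreeAtMost D g = All (λ t → totalDegree (proj₁ t) ≤ D) g

  -- A linear form h(x) = h₁x₁ + ⋯ + hₙxₙ, given by its coefficient vector
  LinearForm : ℕ → Set
  LinearForm n = Vec Carrier n

  evalLinear : ∀ {n} → LinearForm n → Point n → Carrier
  evalLinear h x = foldr _ _+_ 0# (zipWith _*_ h x)

  evalHdPlusG : ∀ {n} → LinearForm n → ℕ → Poly n → Point n → Carrier
  evalHdPlusG h d g x = pow (evalLinear h x) d + eval g x

  -- number of points of S (a duplicate-free list) on the zero set of h^d + g
  richness : ∀ {n} → LinearForm n → ℕ → Poly n → List (Point n) → ℕ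
  richness h d g S = length (filter (λ x → evalHdPlusG h d g x ≟ 0#) S)

  HyperFurstenberg : ∀ {n} → ℕ → ℕ → List (Point n) → Set
  HyperFurstenberg {n} m d S =
    (h : LinearForm n) → ∃ λ (g : Poly n) → DegreeAtMost (d ∸ 1) g × m ≤ richness h d g S

{-# OPTIONS --safe #-}
module Submission where

-- Choose h₁, …, hₙ independently and uniformly among all linear forms and let Z(h) be the zero set of
-- h^d + g_h. By convexity (power means over the points of S) the expected size of S ∩ Z(h₁) ∩ ⋯ ∩ Z(hₙ)
-- is at least m^n / |S|^(n−1). Conversely, if h₁, …, hₙ have rank r, the intersection has at most
-- d^n q^(n−r) points: slice it by the values of n − r further forms completing a basis; on each slice the d-th
-- power of every basis form agrees with a polynomial of degree < d, so every function on the slice is a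
-- combination of the d^n monomials in the basis forms with exponents < d.
-- Since a random matrix has fewer than 2 kernel vectors on average, the expected size is at most 2 d^n.

open import Defs
open import Level using (0ℓ)
open import Algebra.Bundles using (CommutativeRing)
import Algebra.Properties.Ring
import Algebra.Solver.Ring.NaturalCoefficients.Default
open import Data.Nat using (ℕ; zero; suc; _+_; _*_; _∸_; _^_; _≤_; _<_; z≤n; s≤s; _≤?_; _<?_; NonZero; >-nonZero)
open import Data.Nat.Properties
open import Data.Nat.ListAction using (sum)
open import Data.Nat.Primality using (Prime)
open import Data.Nat.Tactic.RingSolver using (solve-∀)
open import Data.Fin using (Fin; zero; suc)
open import Data.List using (List; []; _∷_; _++_; length; allFin; upTo; filter; cartesianProductWith)
import Data.List as List
open import Data.List.Properties using (length-++; length-map; length-filter; length-tabulate; length-upTo)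
open import Data.List.Membership.Propositional using (_∈_; lose)
open import Data.List.Membership.Propositional.Properties using (∈-∃++; ∈-++⁺ˡ; ∈-++⁺ʳ; ∈-++⁻; ∈-map⁺; ∈-allFin; ∈-upTo⁺; ∈-cartesianProductWith⁺; ∈-filter⁻)
open import Data.List.Relation.Unary.Any using (here; there; any?; satisfied)
open import Data.List.Relation.Unary.All using (All; []; _∷_; all?)
import Data.List.Relation.Unary.All as All
open import Data.List.Relation.Unary.All.Properties using (++⁺; map⁺; ¬All⇒Any¬)
open import Data.List.Relation.Unary.AllPairs using ([]; _∷_)
open import Data.List.Relation.Unary.Unique.Propositional using (Unique)
import Data.List.Relation.Unary.Unique.Propositional.Properties as Unique
open import Data.Vec using (Vec; []; _∷_; lookup; zipWith; replicate; fromList; map; tail; _[_]≔_)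
import Data.Vec as Vec
open import Data.Vec.Properties using (≡-dec; ∷-injective; map-lookup-allFin)
open import Data.Product using (_×_; _,_; proj₁; proj₂; ∃; ∃₂)
open import Data.Sum using (_⊎_; inj₁; inj₂)
open import Data.Unit using (⊤; tt)
open import Function using (_∘_)
open import Function.Bundles using (Inverse)
open import Relation.Nullary using (Dec; yes; no; ¬_; contradiction)
open import Relation.Nullary.Decidable using (map′)
open import Relation.Unary using (Decidable)
open import Relation.Binary.PropositionalEquality using (_≡_; _≢_; refl; sym; trans; cong; cong₂; subst; module ≡-Reasoning)

-- Counting and finite sums over lists.

module _ {A : Set} where

  unique-⊆⇒length≤ : {xs ys : List A} → Unique xs → (∀ {x} → x ∈ xs → x ∈ ys) →
                     length xs ≤ length ys
  unique-⊆⇒length≤ {[]} _ _ = z≤n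
  unique-⊆⇒length≤ {x ∷ xs} (x∉xs ∷ uniq) xs⊆ with ∈-∃++ (xs⊆ (here refl))
  ... | as , bs , refl = begin
    suc (length xs)              ≤⟨ s≤s (unique-⊆⇒length≤ uniq rest) ⟩
    suc (length (as ++ bs))      ≡⟨ cong suc (length-++ as) ⟩
    suc (length as + length bs)  ≡⟨ +-suc (length as) (length bs) ⟨
    length as + suc (length bs)  ≡⟨ length-++ as ⟨
    length (as ++ x ∷ bs)        ∎
    where
    open ≤-Reasoning
    rest : ∀ {y} → y ∈ xs → y ∈ as ++ bs
    rest y∈xs with ∈-++⁻ as (xs⊆ (there y∈xs))
    ... | inj₁ y∈as           = ∈-++⁺ˡ y∈as
    ... | inj₂ (here refl)    = contradiction refl (All.lookup x∉xs y∈xs)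
    ... | inj₂ (there y∈bs)   = ∈-++⁺ʳ as y∈bs

  length-cartesianProductWith : {B C : Set} (f : A → B → C) (xs : List A) (ys : List B) →
    length (cartesianProductWith f xs ys) ≡ length xs * length ys
  length-cartesianProductWith f [] ys = refl
  length-cartesianProductWith f (x ∷ xs) ys =
    trans (length-++ (List.map (f x) ys))
          (cong₂ _+_ (length-map (f x) ys) (length-cartesianProductWith f xs ys))

  sum-mono : {f g : A → ℕ} (xs : List A) → (∀ x → f x ≤ g x) → sum (List.map f xs) ≤ sum (List.map g xs)
  sum-mono []       f≤g = z≤n
  sum-mono (x ∷ xs) f≤g = +-mono-≤ (f≤g x) (sum-mono xs f≤g)

  sum-cong : {f g : A → ℕ} (xs : List A) → (∀ x → f x ≡ g x) → sum (List.map f xs) ≡ sum (List.map g xs)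
  sum-cong []       f≡g = refl
  sum-cong (x ∷ xs) f≡g = cong₂ _+_ (f≡g x) (sum-cong xs f≡g)

  sum-const : (c : ℕ) (xs : List A) → sum (List.map (λ _ → c) xs) ≡ length xs * c
  sum-const c []       = refl
  sum-const c (x ∷ xs) = cong (c +_) (sum-const c xs)

  sum-+ : (f g : A → ℕ) (xs : List A) →
          sum (List.map (λ x → f x + g x) xs) ≡ sum (List.map f xs) + sum (List.map g xs)
  sum-+ f g []       = refl
  sum-+ f g (x ∷ xs) rewrite sum-+ f g xs = interchange (f x) (g x) _ _
    where
    interchange : ∀ a b c d → a + b + (c + d) ≡ a + c + (b + d)
    interchange = solve-∀

  sum-*ˡ : (c : ℕ) (f : A → ℕ) (xs : List A) → sum (List.map (λ x → c * f x) xs) ≡ c * sum (List.map f xs)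
  sum-*ˡ c f []       = sym (*-zeroʳ c)
  sum-*ˡ c f (x ∷ xs) rewrite sum-*ˡ c f xs = sym (*-distribˡ-+ c (f x) _)

  sum-*ʳ : (f : A → ℕ) (c : ℕ) (xs : List A) → sum (List.map (λ x → f x * c) xs) ≡ sum (List.map f xs) * c
  sum-*ʳ f c xs = trans (sum-cong xs (λ x → *-comm (f x) c))
                        (trans (sum-*ˡ c f xs) (*-comm c _))

sum-swap : {A B : Set} (f : A → B → ℕ) (xs : List A) (ys : List B) →
  sum (List.map (λ x → sum (List.map (f x) ys)) xs) ≡ sum (List.map (λ y → sum (List.map (λ x → f x y) xs)) ys)
sum-swap f [] ys = sym (trans (sum-const 0 ys) (*-zeroʳ (length ys)))
sum-swap f (x ∷ xs) ys rewrite sum-swap f xs ys = sym (sum-+ (f x) _ ys)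

𝟙 : {P : Set} → Dec P → ℕ
𝟙 (yes _) = 1
𝟙 (no _)  = 0

module _ {A : Set} {P : A → Set} (P? : Decidable P) where

  sum-filter : (f : A → ℕ) (xs : List A) →
               sum (List.map f (filter P? xs)) ≡ sum (List.map (λ x → 𝟙 (P? x) * f x) xs)
  sum-filter f [] = refl
  sum-filter f (x ∷ xs) with P? x
  ... | yes _ = cong₂ _+_ (sym (+-identityʳ (f x))) (sum-filter f xs)
  ... | no _  = sum-filter f xs

  length-filter-sum : (xs : List A) → length (filter P? xs) ≡ sum (List.map (λ x → 𝟙 (P? x)) xs)
  length-filter-sum [] = refl
  length-filter-sum (x ∷ xs) with P? x
  ... | yes _ = cong suc (length-filter-sum xs)
  ... | no _  = length-filter-sum xs

-- Chebyshev's sum inequality and power means.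

^-distribʳ-* : ∀ k a b → (a * b) ^ k ≡ a ^ k * b ^ k
^-distribʳ-* zero    a b = refl
^-distribʳ-* (suc k) a b = trans (cong (a * b *_) (^-distribʳ-* k a b))
                                 ([m*n]*[o*p]≡[m*o]*[n*p] a b (a ^ k) (b ^ k))

-- With b = a + u and b ^ k = a ^ k + v the two sides differ by exactly u * v. Naming the
-- differences keeps the argument free of subtraction in ℕ.
rearrangement-step : ∀ {a b} k → a ≤ b → a * b ^ k + a ^ k * b ≤ a * a ^ k + b * b ^ k
rearrangement-step {a} {b} k a≤b with m≤n⇒∃[o]m+o≡n a≤b | m≤n⇒∃[o]m+o≡n (^-monoˡ-≤ k a≤b)
... | u , refl | v , eq rewrite sym eq = ≤-trans (m≤m+n _ (u * v)) (≤-reflexive (identity a (a ^ k) u v))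
  where
  identity : ∀ a c u v → a * (c + v) + c * (a + u) + u * v ≡ a * c + (a + u) * (c + v)
  identity = solve-∀

rearrangement : ∀ a b k → a * b ^ k + a ^ k * b ≤ a * a ^ k + b * b ^ k
rearrangement a b k with ≤-total a b
... | inj₁ a≤b = rearrangement-step k a≤b
... | inj₂ b≤a = begin
  a * b ^ k + a ^ k * b  ≡⟨ swap a (b ^ k) (a ^ k) b ⟩
  b * a ^ k + b ^ k * a  ≤⟨ rearrangement-step k b≤a ⟩
  b * b ^ k + a * a ^ k  ≡⟨ +-comm (b * b ^ k) _ ⟩
  a * a ^ k + b * b ^ k  ∎
  where
  open ≤-Reasoning
  swap : ∀ a b c d → a * b + c * d ≡ d * c + b * a
  swap = solve-∀

module _ {A : Set} (f : A → ℕ) where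

  -- Chebyshev's inequality for the similarly ordered sequences f and f ^ k. A new head x adds one
  -- cross term for each later y, and `rearrangement` bounds the terms pair by pair.
  chebyshev : ∀ k (xs : List A) →
    sum (List.map f xs) * sum (List.map (λ x → f x ^ k) xs) ≤ length xs * sum (List.map (λ x → f x ^ suc k) xs)
  chebyshev k [] = z≤n
  chebyshev k (x ∷ xs) = begin
    (f x + Σ₁) * (f x ^ k + Σₖ)
      ≡⟨ expand (f x) Σ₁ (f x ^ k) Σₖ ⟩
    f x * f x ^ k + (f x * Σₖ + f x ^ k * Σ₁) + Σ₁ * Σₖ
      ≤⟨ +-mono-≤ (+-monoʳ-≤ (f x * f x ^ k) cross) (chebyshev k xs) ⟩
    f x * f x ^ k + (length xs * (f x * f x ^ k) + Σₖ₊₁) + length xs * Σₖ₊₁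
      ≡⟨ collect (f x * f x ^ k) (length xs) Σₖ₊₁ ⟩
    suc (length xs) * (f x * f x ^ k + Σₖ₊₁) ∎
    where
    open ≤-Reasoning
    Σ₁ = sum (List.map f xs)
    Σₖ = sum (List.map (λ y → f y ^ k) xs)
    Σₖ₊₁ = sum (List.map (λ y → f y ^ suc k) xs)
    expand : ∀ a b c d → (a + b) * (c + d) ≡ a * c + (a * d + c * b) + b * d
    expand = solve-∀
    collect : ∀ a l s → a + (l * a + s) + l * s ≡ (1 + l) * (a + s)
    collect = solve-∀
    cross : f x * Σₖ + f x ^ k * Σ₁ ≤ length xs * (f x * f x ^ k) + Σₖ₊₁
    cross = begin
      f x * Σₖ + f x ^ k * Σ₁
        ≡⟨ cong₂ _+_ (sum-*ˡ (f x) (λ y → f y ^ k) xs) (sum-*ˡ (f x ^ k) f xs) ⟨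
      sum (List.map (λ y → f x * f y ^ k) xs) + sum (List.map (λ y → f x ^ k * f y) xs)
        ≡⟨ sum-+ (λ y → f x * f y ^ k) (λ y → f x ^ k * f y) xs ⟨
      sum (List.map (λ y → f x * f y ^ k + f x ^ k * f y) xs)
        ≤⟨ sum-mono xs (λ y → rearrangement (f x) (f y) k) ⟩
      sum (List.map (λ y → f x * f x ^ k + f y ^ suc k) xs)
        ≡⟨ sum-+ (λ _ → f x * f x ^ k) (λ y → f y ^ suc k) xs ⟩
      sum (List.map (λ _ → f x * f x ^ k) xs) + Σₖ₊₁
        ≡⟨ cong (_+ Σₖ₊₁) (sum-const (f x * f x ^ k) xs) ⟩
      length xs * (f x * f x ^ k) + Σₖ₊₁ ∎

  -- Jensen's inequality for the power k + 1, cleared of denominators. Each step of the induction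
  -- trades one factor Σ f for a factor `length xs` by Chebyshev.
  power-mean : ∀ k (xs : List A) →
    sum (List.map f xs) ^ suc k ≤ length xs ^ k * sum (List.map (λ x → f x ^ suc k) xs)
  power-mean zero xs = ≤-reflexive (begin
    sum (List.map f xs) * 1                     ≡⟨ sum-*ʳ f 1 xs ⟨
    sum (List.map (λ x → f x * 1) xs)           ≡⟨ +-identityʳ _ ⟨
    1 * sum (List.map (λ x → f x * 1) xs)       ∎)
    where open ≡-Reasoning
  power-mean (suc k) xs = begin
    Σ₁ * Σ₁ ^ suc k                             ≤⟨ *-monoʳ-≤ Σ₁ (power-mean k xs) ⟩
    Σ₁ * (length xs ^ k * Σₖ₊₁)                 ≡⟨ shuffle Σ₁ (length xs ^ k) Σₖ₊₁ ⟩
    length xs ^ k * (Σ₁ * Σₖ₊₁)                 ≤⟨ *-monoʳ-≤ (length xs ^ k) (chebyshev (suc k) xs) ⟩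
    length xs ^ k * (length xs * Σₖ₊₂)          ≡⟨ assoc (length xs ^ k) (length xs) Σₖ₊₂ ⟩
    length xs ^ suc k * Σₖ₊₂                    ∎
    where
    open ≤-Reasoning
    Σ₁ = sum (List.map f xs)
    Σₖ₊₁ = sum (List.map (λ x → f x ^ suc k) xs)
    Σₖ₊₂ = sum (List.map (λ x → f x ^ suc (suc k)) xs)
    shuffle : ∀ a b c → a * (b * c) ≡ b * (a * c)
    shuffle = solve-∀
    assoc : ∀ a b c → a * (b * c) ≡ b * a * c
    assoc = solve-∀

-- Enumeration of a finite field and of its vectors.

module _ {q : ℕ} (F : FiniteField q) where

  open FiniteField F renaming (_+_ to _⊕_; _*_ to _⊗_; -_ to ⊖_; _≟_ to _≟ᶠ_)

  R : CommutativeRing 0ℓ 0ℓ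
  R = record { isCommutativeRing = isCommutativeRing }

  module K where
    open CommutativeRing R public
    open Algebra.Properties.Ring ring public
    open Algebra.Solver.Ring.NaturalCoefficients.Default commutativeSemiring public

  carriers : List Carrier
  carriers = List.map (Inverse.to enumeration) (allFin q)

  length-carriers : length carriers ≡ q
  length-carriers = trans (length-map _ (allFin q)) (length-tabulate {n = q} (λ i → i))

  ∈-carriers : ∀ c → c ∈ carriers
  ∈-carriers c = subst (_∈ carriers) (Inverse.strictlyInverseˡ enumeration c)
                       (∈-map⁺ (Inverse.to enumeration) (∈-allFin _))

  unique-carriers : Unique carriers
  unique-carriers = Unique.map⁺ injective (Unique.allFin⁺ q)
    where
    injective : ∀ {i j} → Inverse.to enumeration i ≡ Inverse.to enumeration j → i ≡ j
    injective eq = trans (sym (Inverse.strictlyInverseʳ enumeration _))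
      (trans (cong (Inverse.from enumeration) eq) (Inverse.strictlyInverseʳ enumeration _))

  1<q : 1 < q
  1<q = subst (2 ≤_) length-carriers
    (unique-⊆⇒length≤ {xs = 0# ∷ 1# ∷ []} ((0≢1 ∷ []) ∷ [] ∷ []) (λ {x} _ → ∈-carriers x))

  vectors : ∀ k → List (Vec Carrier k)
  vectors zero    = [] ∷ []
  vectors (suc k) = cartesianProductWith _∷_ carriers (vectors k)

  length-vectors : ∀ k → length (vectors k) ≡ q ^ k
  length-vectors zero    = refl
  length-vectors (suc k) = trans (length-cartesianProductWith _∷_ carriers (vectors k))
                                 (cong₂ _*_ length-carriers (length-vectors k))

  ∈-vectors : ∀ {k} (v : Vec Carrier k) → v ∈ vectors k
  ∈-vectors []      = here refl
  ∈-vectors (c ∷ v) = ∈-cartesianProductWith⁺ _∷_ (∈-carriers c) (∈-vectors v)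

  unique-vectors : ∀ k → Unique (vectors k)
  unique-vectors zero    = [] ∷ []
  unique-vectors (suc k) = Unique.cartesianProductWith⁺ _∷_ ∷-injective unique-carriers (unique-vectors k)

  -- Cardinalities take the place of dimension theory: an injection gives q ^ j ≤ q ^ k, and q > 1
  -- allows the exponents to be compared.
  injection⇒≤ : ∀ {j k} (f : Vec Carrier j → Vec Carrier k) → (∀ {u v} → f u ≡ f v → u ≡ v) → j ≤ k
  injection⇒≤ {j} {k} f f-injective with j ≤? k
  ... | yes j≤k = j≤k
  ... | no j≰k  = contradiction q^j≤q^k (<⇒≱ (^-monoʳ-< q 1<q (≰⇒> j≰k)))
    where
    q^j≤q^k : q ^ j ≤ q ^ k
    q^j≤q^k = subst (λ l → l ≤ q ^ k)
      (trans (length-map f (vectors j)) (length-vectors j))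
      (subst (length (List.map f (vectors j)) ≤_) (length-vectors k)
        (unique-⊆⇒length≤ (Unique.map⁺ f-injective (unique-vectors j)) (λ {v} _ → ∈-vectors v)))

  -- Linear forms

  linear-+ : ∀ {k} (c c′ x : Vec Carrier k) →
             evalLinear (zipWith _⊕_ c c′) x ≡ evalLinear c x ⊕ evalLinear c′ x
  linear-+ [] [] [] = sym (K.+-identityˡ 0#)
  linear-+ (a ∷ c) (b ∷ c′) (x ∷ xs) rewrite linear-+ c c′ xs =
    K.solve 5 (λ a b x u v → (a K.:+ b) K.:* x K.:+ (u K.:+ v) K.:= (a K.:* x K.:+ u) K.:+ (b K.:* x K.:+ v))
      refl a b x (evalLinear c xs) (evalLinear c′ xs)

  linear-* : ∀ {k} a (c x : Vec Carrier k) → evalLinear (map (a ⊗_) c) x ≡ a ⊗ evalLinear c x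
  linear-* a [] [] = sym (K.zeroʳ a)
  linear-* a (b ∷ c) (x ∷ xs) rewrite linear-* a c xs =
    K.solve 4 (λ a b x u → a K.:* b K.:* x K.:+ a K.:* u K.:= a K.:* (b K.:* x K.:+ u))
      refl a b x (evalLinear c xs)

  linear-0 : ∀ {k} (x : Vec Carrier k) → evalLinear (replicate k 0#) x ≡ 0#
  linear-0 []       = refl
  linear-0 (x ∷ xs) rewrite linear-0 xs = trans (K.+-identityʳ _) (K.zeroˡ x)

  linear-unit : ∀ {k} (i : Fin k) (x : Vec Carrier k) →
                evalLinear (replicate k 0# [ i ]≔ 1#) x ≡ lookup x i
  linear-unit zero (x ∷ xs) rewrite linear-0 xs = trans (K.+-identityʳ _) (K.*-identityˡ x)
  linear-unit (suc i) (x ∷ xs) rewrite linear-unit i xs | K.zeroˡ x = K.+-identityˡ _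

  combination : ∀ {n r} → Vec (LinearForm n) r → Vec Carrier r → LinearForm n
  combination []      []      = replicate _ 0#
  combination (ℓ ∷ L) (c ∷ cs) = zipWith _⊕_ (map (c ⊗_) ℓ) (combination L cs)

  values : ∀ {n r} → Vec (LinearForm n) r → Point n → Point r
  values L x = map (λ ℓ → evalLinear ℓ x) L

  evalLinear-combination : ∀ {n r} (L : Vec (LinearForm n) r) c x →
                           evalLinear (combination L c) x ≡ evalLinear c (values L x)
  evalLinear-combination []      []       x = linear-0 x
  evalLinear-combination (ℓ ∷ L) (c ∷ cs) x = trans (linear-+ (map (c ⊗_) ℓ) _ x)
    (cong₂ _⊕_ (linear-* c ℓ x) (evalLinear-combination L cs x))

  InSpan : ∀ {n r} → Vec (LinearForm n) r → LinearForm n → Set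
  InSpan L h = ∃ λ c → combination L c ≡ h

  inSpan? : ∀ {n r} (L : Vec (LinearForm n) r) h → Dec (InSpan L h)
  inSpan? {r = r} L h = map′ satisfied (λ (c , eq) → lose (∈-vectors c) eq)
    (any? (λ c → ≡-dec _≟ᶠ_ (combination L c) h) (vectors r))

  -- Over a field this is linear independence. The recursive form suits bases that grow by one form
  -- at the head, where only the new form has to be checked.
  Independent : ∀ {n r} → Vec (LinearForm n) r → Set
  Independent []      = ⊤
  Independent (ℓ ∷ L) = ¬ InSpan L ℓ × Independent L

  -- The span is the image of the q ^ r coefficient vectors. Divided by q ^ n, this bounds the
  -- probability that a random form does not raise the rank.
  spanSize : ∀ {n r} (L : Vec (LinearForm n) r) → length (filter (inSpan? L) (vectors n)) ≤ q ^ r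
  spanSize {n} {r} L = subst (length (filter (inSpan? L) (vectors n)) ≤_)
    (trans (length-map (combination L) (vectors r)) (length-vectors r))
    (unique-⊆⇒length≤ (Unique.filter⁺ (inSpan? L) (unique-vectors n)) spanned)
    where
    spanned : ∀ {h} → h ∈ filter (inSpan? L) (vectors n) → h ∈ List.map (combination L) (vectors r)
    spanned h∈ with ∈-filter⁻ (inSpan? L) {xs = vectors n} h∈
    ... | _ , c , refl = ∈-map⁺ (combination L) (∈-vectors c)

  _⊝_ : Carrier → Carrier → Carrier
  a ⊝ b = a ⊕ ⊖ b

  -- Linearity of `combination L`, for the one operation k (u - v) that the proof of injectivity
  -- performs on coefficients.
  combination-⊝ : ∀ {n r} k (L : Vec (LinearForm n) r) c c′ →
    combination L (zipWith (λ a b → k ⊗ (a ⊝ b)) c c′) ≡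
    zipWith (λ u v → k ⊗ (u ⊝ v)) (combination L c) (combination L c′)
  combination-⊝ {n} k [] [] [] = zeros n
    where
    zeros : ∀ n → replicate n 0# ≡ zipWith (λ u v → k ⊗ (u ⊝ v)) (replicate n 0#) (replicate n 0#)
    zeros zero    = refl
    zeros (suc n) = cong₂ _∷_ (sym (trans (cong (k ⊗_) (K.-‿inverseʳ 0#)) (K.zeroʳ k))) (zeros n)
  combination-⊝ k (ℓ ∷ L) (a ∷ c) (b ∷ c′) rewrite combination-⊝ k L c c′ = pointwise ℓ _ _
    where
    open ≡-Reasoning
    entry : ∀ l u v → k ⊗ (a ⊝ b) ⊗ l ⊕ k ⊗ (u ⊝ v) ≡ k ⊗ ((a ⊗ l ⊕ u) ⊝ (b ⊗ l ⊕ v))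
    entry l u v = begin
      k ⊗ (a ⊕ ⊖ b) ⊗ l ⊕ k ⊗ (u ⊕ ⊖ v)
        ≡⟨ K.solve 6 (λ k a b l u v → k K.:* (a K.:+ b) K.:* l K.:+ k K.:* (u K.:+ v)
             K.:= k K.:* ((a K.:* l K.:+ u) K.:+ (b K.:* l K.:+ v))) refl k a (⊖ b) l u (⊖ v) ⟩
      k ⊗ ((a ⊗ l ⊕ u) ⊕ (⊖ b ⊗ l ⊕ ⊖ v))
        ≡⟨ cong (λ w → k ⊗ ((a ⊗ l ⊕ u) ⊕ w)) (trans (cong (_⊕ ⊖ v) (sym (K.-‿distribˡ-* b l))) (K.-‿+-comm (b ⊗ l) v)) ⟩
      k ⊗ ((a ⊗ l ⊕ u) ⊝ (b ⊗ l ⊕ v)) ∎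
    pointwise : ∀ {n} (ℓ u v : Vec Carrier n) →
      zipWith _⊕_ (map (k ⊗ (a ⊝ b) ⊗_) ℓ) (zipWith (λ u v → k ⊗ (u ⊝ v)) u v) ≡
      zipWith (λ u v → k ⊗ (u ⊝ v)) (zipWith _⊕_ (map (a ⊗_) ℓ) u) (zipWith _⊕_ (map (b ⊗_) ℓ) v)
    pointwise []      []      []      = refl
    pointwise (l ∷ ℓ) (u ∷ us) (v ∷ vs) = cong₂ _∷_ (entry l u v) (pointwise ℓ us vs)

  ⊕-cancelˡ-zipWith : ∀ {n} (u v w : Vec Carrier n) → zipWith _⊕_ u v ≡ zipWith _⊕_ u w → v ≡ w
  ⊕-cancelˡ-zipWith []      []      []      _  = refl
  ⊕-cancelˡ-zipWith (a ∷ u) (b ∷ v) (c ∷ w) eq with ∷-injective eq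
  ... | eq₀ , eqs = cong₂ _∷_ (K.+-cancelˡ a b c eq₀) (⊕-cancelˡ-zipWith u v w eqs)

  -- The second hypothesis says (a - b) ℓ = v - u, and k is the inverse of a - b.
  solve-for : ∀ {n} k a b (ℓ u v : Vec Carrier n) → (a ⊝ b) ⊗ k ≡ 1# →
    zipWith _⊕_ (map (a ⊗_) ℓ) u ≡ zipWith _⊕_ (map (b ⊗_) ℓ) v →
    zipWith (λ x y → k ⊗ (x ⊝ y)) v u ≡ ℓ
  solve-for k a b []      []       []       _   _  = refl
  solve-for k a b (l ∷ ℓ) (u ∷ us) (v ∷ vs) inv eq with ∷-injective eq
  ... | eq₀ , eqs = cong₂ _∷_ entry (solve-for k a b ℓ us vs inv eqs)
    where
    open ≡-Reasoning
    entry : k ⊗ (v ⊝ u) ≡ l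
    entry = begin
      k ⊗ (v ⊕ ⊖ u)
        ≡⟨ cong (λ w → k ⊗ (w ⊕ ⊖ u)) (K.+-identityˡ v) ⟨
      k ⊗ ((0# ⊕ v) ⊕ ⊖ u)
        -- Zero is expanded to - bl + bl so that bl + v can be exchanged for al + u.
        ≡⟨ cong (λ w → k ⊗ ((w ⊕ v) ⊕ ⊖ u)) (K.-‿inverseˡ (b ⊗ l)) ⟨
      k ⊗ (((⊖ (b ⊗ l) ⊕ b ⊗ l) ⊕ v) ⊕ ⊖ u)
        ≡⟨ cong (λ w → k ⊗ (w ⊕ ⊖ u)) (trans (K.+-assoc _ _ _) (cong (⊖ (b ⊗ l) ⊕_) (sym eq₀))) ⟩
      k ⊗ ((⊖ (b ⊗ l) ⊕ (a ⊗ l ⊕ u)) ⊕ ⊖ u)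
        ≡⟨ cong (k ⊗_) (trans (K.+-assoc _ _ _) (cong (⊖ (b ⊗ l) ⊕_)
             (trans (K.+-assoc _ _ _) (trans (cong (a ⊗ l ⊕_) (K.-‿inverseʳ u)) (K.+-identityʳ _))))) ⟩
      k ⊗ (⊖ (b ⊗ l) ⊕ a ⊗ l)
        ≡⟨ cong (λ w → k ⊗ (w ⊕ a ⊗ l)) (K.-‿distribˡ-* b l) ⟩
      k ⊗ (⊖ b ⊗ l ⊕ a ⊗ l)
        ≡⟨ K.solve 4 (λ k a b l → k K.:* (b K.:* l K.:+ a K.:* l) K.:= ((a K.:+ b) K.:* k) K.:* l) refl k a (⊖ b) l ⟩
      (a ⊝ b) ⊗ k ⊗ l
        ≡⟨ trans (cong (_⊗ l) inv) (K.*-identityˡ l) ⟩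
      l ∎

  -- Equal leading coefficients cancel. Different ones could be divided by their difference, which
  -- would express ℓ through L, against independence.
  combination-injective : ∀ {n r} (L : Vec (LinearForm n) r) → Independent L →
                          ∀ {c c′} → combination L c ≡ combination L c′ → c ≡ c′
  combination-injective []      _ {[]} {[]} _ = refl
  combination-injective (ℓ ∷ L) (ℓ∉L , ind) {a ∷ c} {b ∷ c′} eq with a ≟ᶠ b
  ... | yes refl = cong (a ∷_) (combination-injective L ind (⊕-cancelˡ-zipWith _ _ _ eq))
  ... | no a≢b with inverse (a ⊝ b) (λ eq → a≢b (K.x∙y⁻¹≈ε⇒x≈y a b eq))
  ... | k , inv = contradiction
    (_ , trans (combination-⊝ k L c′ c) (solve-for k a b ℓ _ _ inv eq)) ℓ∉L

  independent⇒≤ : ∀ {n r} (L : Vec (LinearForm n) r) → Independent L → r ≤ n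
  independent⇒≤ L ind = injection⇒≤ (combination L) (combination-injective L ind)

  -- Constructively available because there are finitely many forms and membership in a span is
  -- decidable.
  extendable-or-spanning : ∀ {n r} (L : Vec (LinearForm n) r) →
    (∃ λ h → ¬ InSpan L h) ⊎ (∀ h → InSpan L h)
  extendable-or-spanning {n} L with all? (inSpan? L) (vectors n)
  ... | yes all = inj₂ (λ h → All.lookup all (∈-vectors h))
  ... | no ¬all = inj₁ (satisfied (¬All⇒Any¬ (inSpan? L) (vectors n) ¬all))

  -- Polynomials

  pow-+ : ∀ y a b → pow y (a + b) ≡ pow y a ⊗ pow y b
  pow-+ y zero    b = sym (K.*-identityˡ _)
  pow-+ y (suc a) b = trans (cong (y ⊗_) (pow-+ y a b)) (sym (K.*-assoc y _ _))

  monomial-+ : ∀ {r} (a b : Vec ℕ r) y →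
               monomial (zipWith _+_ a b) y ≡ monomial a y ⊗ monomial b y
  monomial-+ []      []      []      = sym (K.*-identityˡ 1#)
  monomial-+ (a ∷ as) (b ∷ bs) (y ∷ ys) rewrite pow-+ y a b | monomial-+ as bs ys =
    K.solve 4 (λ u v w z → u K.:* v K.:* (w K.:* z) K.:= u K.:* w K.:* (v K.:* z)) refl
      (pow y a) (pow y b) (monomial as ys) (monomial bs ys)

  totalDegree-+ : ∀ {r} (a b : Vec ℕ r) → totalDegree (zipWith _+_ a b) ≡ totalDegree a + totalDegree b
  totalDegree-+ []       []       = refl
  totalDegree-+ (a ∷ as) (b ∷ bs) rewrite totalDegree-+ as bs = interchange a b _ _
    where
    interchange : ∀ a b c d → a + b + (c + d) ≡ a + c + (b + d)
    interchange = solve-∀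

  monomial-0 : ∀ {r} (y : Point r) → monomial (replicate r 0) y ≡ 1#
  monomial-0 []       = refl
  monomial-0 (y ∷ ys) = trans (K.*-identityˡ _) (monomial-0 ys)

  totalDegree-0 : ∀ r → totalDegree (replicate r 0) ≡ 0
  totalDegree-0 zero    = refl
  totalDegree-0 (suc r) = totalDegree-0 r

  monomial-var : ∀ {r} (i : Fin r) (y : Point r) → monomial (replicate r 0 [ i ]≔ 1) y ≡ lookup y i
  monomial-var zero    (y ∷ ys) rewrite monomial-0 ys = trans (K.*-identityʳ _) (K.*-identityʳ y)
  monomial-var (suc i) (y ∷ ys) = trans (K.*-identityˡ _) (monomial-var i ys)

  totalDegree-var : ∀ {r} (i : Fin r) → totalDegree (replicate r 0 [ i ]≔ 1) ≡ 1
  totalDegree-var {suc r} zero    = cong suc (totalDegree-0 r)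
  totalDegree-var         (suc i) = totalDegree-var i

  eval-++ : ∀ {r} (p p′ : Poly r) y → eval (p ++ p′) y ≡ eval p y ⊕ eval p′ y
  eval-++ []            p′ y = sym (K.+-identityˡ _)
  eval-++ ((a , c) ∷ p) p′ y = trans (cong (c ⊗ monomial a y ⊕_) (eval-++ p p′ y)) (sym (K.+-assoc _ _ _))

  termMul : ∀ {r} → Vec ℕ r × Carrier → Poly r → Poly r
  termMul (a , c) = List.map (λ (b , c′) → zipWith _+_ a b , c ⊗ c′)

  eval-termMul : ∀ {r} a c (p : Poly r) y → eval (termMul (a , c) p) y ≡ c ⊗ monomial a y ⊗ eval p y
  eval-termMul a c []             y = sym (K.zeroʳ _)
  eval-termMul a c ((b , c′) ∷ p) y rewrite monomial-+ a b y | eval-termMul a c p y =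
    K.solve 5 (λ c c′ u v w → c K.:* c′ K.:* (u K.:* v) K.:+ c K.:* u K.:* w K.:= c K.:* u K.:* (c′ K.:* v K.:+ w))
      refl c c′ (monomial a y) (monomial b y) (eval p y)

  degree-termMul : ∀ {r j k} {a : Vec ℕ r} {c} {p : Poly r} → totalDegree a ≤ j → DegreeAtMost k p →
                   DegreeAtMost (j + k) (termMul (a , c) p)
  degree-termMul {a = a} a≤j p≤k = map⁺ (All.map
    (λ {(b , _)} b≤k → ≤-trans (≤-reflexive (totalDegree-+ a b)) (+-mono-≤ a≤j b≤k)) p≤k)

  polyMul : ∀ {r} → Poly r → Poly r → Poly r
  polyMul []      p′ = []
  polyMul (t ∷ p) p′ = termMul t p′ ++ polyMul p p′

  eval-polyMul : ∀ {r} (p p′ : Poly r) y → eval (polyMul p p′) y ≡ eval p y ⊗ eval p′ y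
  eval-polyMul []            p′ y = sym (K.zeroˡ _)
  eval-polyMul ((a , c) ∷ p) p′ y = begin
    eval (termMul (a , c) p′ ++ polyMul p p′) y            ≡⟨ eval-++ (termMul (a , c) p′) _ y ⟩
    eval (termMul (a , c) p′) y ⊕ eval (polyMul p p′) y    ≡⟨ cong₂ _⊕_ (eval-termMul a c p′ y) (eval-polyMul p p′ y) ⟩
    c ⊗ monomial a y ⊗ eval p′ y ⊕ eval p y ⊗ eval p′ y    ≡⟨ K.distribʳ (eval p′ y) _ _ ⟨
    (c ⊗ monomial a y ⊕ eval p y) ⊗ eval p′ y              ∎
    where open ≡-Reasoning

  degree-polyMul : ∀ {r j k} {p p′ : Poly r} → DegreeAtMost j p → DegreeAtMost k p′ →
                   DegreeAtMost (j + k) (polyMul p p′)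
  degree-polyMul []          p′≤k = []
  degree-polyMul (t≤j ∷ p≤j) p′≤k = ++⁺ (degree-termMul t≤j p′≤k) (degree-polyMul p≤j p′≤k)

  -- Polynomials are compared as functions of the point, and Y supplies the variables. Passing from
  -- the coordinates to the values of basis forms is then only a change of Y.
  PolynomialIn : ∀ {n r} → (Point n → Point r) → ℕ → (Point n → Carrier) → Set
  PolynomialIn {r = r} Y k f = ∃ λ (p : Poly r) → DegreeAtMost k p × (∀ x → f x ≡ eval p (Y x))

  module _ {n r : ℕ} {Y : Point n → Point r} where

    polynomial-const : ∀ c → PolynomialIn Y 0 (λ _ → c)
    polynomial-const c = (replicate r 0 , c) ∷ [] , ≤-reflexive (totalDegree-0 r) ∷ [] ,
      λ x → sym (trans (K.+-identityʳ _) (trans (cong (c ⊗_) (monomial-0 (Y x))) (K.*-identityʳ c)))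

    polynomial-var : ∀ i → PolynomialIn Y 1 (λ x → lookup (Y x) i)
    polynomial-var i = (replicate r 0 [ i ]≔ 1 , 1#) ∷ [] , ≤-reflexive (totalDegree-var i) ∷ [] ,
      λ x → sym (trans (K.+-identityʳ _) (trans (K.*-identityˡ _) (monomial-var i (Y x))))

    polynomial-weaken : ∀ {j k f} → j ≤ k → PolynomialIn Y j f → PolynomialIn Y k f
    polynomial-weaken j≤k (p , p≤j , f≡p) = p , All.map (λ t≤j → ≤-trans t≤j j≤k) p≤j , f≡p

    polynomial-+ : ∀ {k f g} → PolynomialIn Y k f → PolynomialIn Y k g →
                   PolynomialIn Y k (λ x → f x ⊕ g x)
    polynomial-+ (p , p≤k , f≡p) (p′ , p′≤k , g≡p′) = p ++ p′ , ++⁺ p≤k p′≤k ,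
      λ x → trans (cong₂ _⊕_ (f≡p x) (g≡p′ x)) (sym (eval-++ p p′ (Y x)))

    polynomial-* : ∀ {j k f g} → PolynomialIn Y j f → PolynomialIn Y k g →
                   PolynomialIn Y (j + k) (λ x → f x ⊗ g x)
    polynomial-* (p , p≤j , f≡p) (p′ , p′≤k , g≡p′) = polyMul p p′ , degree-polyMul p≤j p′≤k ,
      λ x → trans (cong₂ _⊗_ (f≡p x) (g≡p′ x)) (sym (eval-polyMul p p′ (Y x)))

    polynomial-≗ : ∀ {k f g} → (∀ x → g x ≡ f x) → PolynomialIn Y k f → PolynomialIn Y k g
    polynomial-≗ g≡f (p , p≤k , f≡p) = p , p≤k , λ x → trans (g≡f x) (f≡p x)

    polynomial-linear : ∀ c → PolynomialIn Y 1 (λ x → evalLinear c (Y x))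
    -- The vector Y x varies with x, so the induction runs over the fixed vector of its indices
    -- instead.
    polynomial-linear c = polynomial-≗ (λ x → cong (evalLinear c) (sym (map-lookup-allFin (Y x))))
                                       (go c (Vec.allFin r))
      where
      go : ∀ {s} (c : Vec Carrier s) (is : Vec (Fin r) s) →
           PolynomialIn Y 1 (λ x → evalLinear c (map (lookup (Y x)) is))
      go []       []       = polynomial-weaken z≤n (polynomial-const 0#)
      go (c ∷ cs) (i ∷ is) = polynomial-+ (polynomial-* (polynomial-const c) (polynomial-var i)) (go cs is)

    polynomial-pow : ∀ {f} → PolynomialIn Y 1 f → ∀ e → PolynomialIn Y e (λ x → pow (f x) e)
    polynomial-pow Pf zero    = polynomial-const 1#
    polynomial-pow Pf (suc e) = polynomial-* Pf (polynomial-pow Pf e)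

    -- Substituting functions of degree at most 1 for the variables does not raise the degree. The
    -- map X is general so that the induction can pass to `tail ∘ X`.
    polynomial-monomial : ∀ {s} (X : Point n → Point s) →
      (∀ j → PolynomialIn Y 1 (λ x → lookup (X x) j)) →
      ∀ es → PolynomialIn Y (totalDegree es) (λ x → monomial es (X x))
    polynomial-monomial X PX []       = polynomial-≗ (λ x → empty (X x)) (polynomial-const 1#)
      where
      empty : (v : Point 0) → monomial [] v ≡ 1#
      empty [] = refl
    polynomial-monomial X PX (e ∷ es) = polynomial-≗ (λ x → cons (X x)) (polynomial-*
      (polynomial-pow (PX zero) e)
      (polynomial-monomial (tail ∘ X) (λ j → polynomial-≗ (λ x → lookup-tail (X x) j) (PX (suc j))) es))
      where
      cons : ∀ {s} {es : Vec ℕ s} (v : Point (suc s)) →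
             monomial (e ∷ es) v ≡ pow (lookup v zero) e ⊗ monomial es (tail v)
      cons (_ ∷ _) = refl
      lookup-tail : ∀ {s} (v : Point (suc s)) j → lookup (tail v) j ≡ lookup v (suc j)
      lookup-tail (_ ∷ _) j = refl

    module _ (coordinates : ∀ j → PolynomialIn Y 1 (λ x → lookup x j)) where

      -- Preserving the degree bound here is what keeps g of degree below d after it is rewritten in
      -- the basis forms.
      polynomial-eval : ∀ {k} (g : Poly n) → DegreeAtMost k g → PolynomialIn Y k (eval g)
      polynomial-eval []            []            = polynomial-weaken z≤n (polynomial-const 0#)
      polynomial-eval ((e , c) ∷ g) (e≤k ∷ g≤k) = polynomial-+
        (polynomial-weaken e≤k (polynomial-* (polynomial-const c) (polynomial-monomial (λ x → x) coordinates e)))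
        (polynomial-eval g g≤k)

      -- A Lagrange factor: at a coordinate j where the points differ, x_j - w_j is scaled by the
      -- inverse of z_j - w_j.
      separate : ∀ {z w} → z ≢ w → ∃ λ f → PolynomialIn Y 1 f × f z ≡ 1# × f w ≡ 0#
      separate {z} {w} z≢w with distinguish z w z≢w
        where
        distinguish : ∀ {s} (z w : Point s) → z ≢ w → ∃ λ j → lookup z j ≢ lookup w j
        distinguish []      []      z≢w = contradiction refl z≢w
        distinguish (a ∷ z) (b ∷ w) z≢w with a ≟ᶠ b
        ... | no a≢b   = zero , a≢b
        ... | yes refl with distinguish z w (z≢w ∘ cong (a ∷_))
        ...   | j , zⱼ≢wⱼ = suc j , zⱼ≢wⱼ
      ... | j , zⱼ≢wⱼ with inverse (lookup z j ⊝ lookup w j) (zⱼ≢wⱼ ∘ K.x∙y⁻¹≈ε⇒x≈y _ _)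
      ... | u , inv = (λ x → (lookup x j ⊝ lookup w j) ⊗ u) ,
        polynomial-* (polynomial-+ (coordinates j) (polynomial-weaken z≤n (polynomial-const _))) (polynomial-const u) ,
        inv , trans (cong (_⊗ u) (K.-‿inverseʳ (lookup w j))) (K.zeroˡ u)

      -- The product of the Lagrange factors for the points of Z. Its degree is left existential,
      -- since `reduce` later accepts any degree.
      indicator : ∀ {z} (Z : List (Point n)) → All (z ≢_) Z →
        ∃₂ λ k f → PolynomialIn Y k f × f z ≡ 1# × All (λ w → f w ≡ 0#) Z
      indicator []      []          = 0 , (λ _ → 1#) , polynomial-const 1# , refl , []
      indicator (w ∷ Z) (z≢w ∷ z∉Z) with separate z≢w | indicator Z z∉Z
      ... | f , Pf , fz≡1 , fw≡0 | k , g , Pg , gz≡1 , g≡0 =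
        suc k , (λ x → f x ⊗ g x) , polynomial-* Pf Pg ,
        trans (cong₂ _⊗_ fz≡1 gz≡1) (K.*-identityˡ 1#) ,
        trans (cong (_⊗ g w) fw≡0) (K.zeroˡ _) ∷
        All.map (λ {x} gx≡0 → trans (cong (f x ⊗_) gx≡0) (K.zeroʳ _)) g≡0

      -- Newton interpolation: a multiple of the indicator of z corrects the value at z and leaves
      -- the values on the remaining points alone.
      interpolate : (Z : List (Point n)) → Unique Z → (v : Vec Carrier (length Z)) →
        ∃₂ λ k f → PolynomialIn Y k f × map f (fromList Z) ≡ v
      interpolate []      _             []      = 0 , (λ _ → 0#) , polynomial-const 0# , refl
      interpolate (z ∷ Z) (z∉Z ∷ uniq) (v ∷ vs) with interpolate Z uniq vs | indicator Z z∉Z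
      ... | j , f , Pf , f≡vs | k , δ , Pδ , δz≡1 , δ≡0 =
        j + k , (λ x → f x ⊕ (v ⊝ f z) ⊗ δ x) ,
        polynomial-+ (polynomial-weaken (m≤m+n j k) Pf)
          (polynomial-weaken (m≤n+m k j) (polynomial-* (polynomial-const _) Pδ)) ,
        cong₂ _∷_ at-z (trans (at-Z Z δ≡0) f≡vs)
        where
        open ≡-Reasoning
        at-z : f z ⊕ (v ⊝ f z) ⊗ δ z ≡ v
        at-z = begin
          f z ⊕ (v ⊝ f z) ⊗ δ z  ≡⟨ cong (λ t → f z ⊕ (v ⊝ f z) ⊗ t) δz≡1 ⟩
          f z ⊕ (v ⊝ f z) ⊗ 1#   ≡⟨ cong (f z ⊕_) (K.*-identityʳ _) ⟩
          f z ⊕ (v ⊕ ⊖ f z)      ≡⟨ K.+-assoc (f z) v _ ⟨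
          f z ⊕ v ⊕ ⊖ f z        ≡⟨ K.xyx⁻¹≈y (f z) v ⟩
          v                      ∎
        at-Z : ∀ Z → All (λ w → δ w ≡ 0#) Z → map (λ x → f x ⊕ (v ⊝ f z) ⊗ δ x) (fromList Z) ≡ map f (fromList Z)
        at-Z []      []            = refl
        at-Z (w ∷ Z) (δw≡0 ∷ δ≡0) = cong₂ _∷_
          (trans (cong (λ t → f w ⊕ (v ⊝ f z) ⊗ t) δw≡0) (trans (cong (f w ⊕_) (K.zeroʳ _)) (K.+-identityʳ _)))
          (at-Z Z δ≡0)

  -- Points on hypersurfaces whose leading forms are powers of linear forms

  -- The vector has c at the position of a and 0 elsewhere. It is chosen before φ, which will be the
  -- evaluation of monomials at a varying point.
  coefficient-vector : ∀ {A : Set} {a : A} (E : List A) → a ∈ E → ∀ c →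
    ∃ λ cs → ∀ (φ : A → Carrier) → evalLinear cs (map φ (fromList E)) ≡ c ⊗ φ a
  coefficient-vector (a ∷ E) (here refl) c = c ∷ replicate _ 0# ,
    λ φ → trans (cong (c ⊗ φ a ⊕_) (linear-0 (map φ (fromList E)))) (K.+-identityʳ _)
  coefficient-vector (b ∷ E) (there a∈E) c with coefficient-vector E a∈E c
  ... | cs , eq = 0# ∷ cs , λ φ → trans (cong₂ _⊕_ (K.zeroˡ _) (eq φ)) (K.+-identityˡ _)

  module _ (e : ℕ) where

    private
      -- With d = e + 1 the degree bound `d ∸ 1` computes to e.
      d : ℕ
      d = suc e

    exponents : ∀ r → List (Vec ℕ r)
    exponents zero    = [] ∷ []
    exponents (suc r) = cartesianProductWith _∷_ (upTo d) (exponents r)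

    length-exponents : ∀ r → length (exponents r) ≡ d ^ r
    length-exponents zero    = refl
    length-exponents (suc r) = trans (length-cartesianProductWith _∷_ (upTo d) (exponents r))
                                     (cong₂ _*_ (length-upTo d) (length-exponents r))

    Reduced : ∀ {r} → Poly r → Set
    Reduced {r} p = All (λ t → proj₁ t ∈ exponents r) p

    -- The first exponent that is at least d gives up the factor. The degree equation is recorded
    -- because replacing that factor by a polynomial of degree at most e must lower the total
    -- degree.
    reduced-or-divisible : ∀ {r} (a : Vec ℕ r) → a ∈ exponents r ⊎
      (∃₂ λ i a′ → totalDegree a ≡ d + totalDegree a′ ×
                   (∀ y → monomial a y ≡ pow (lookup y i) d ⊗ monomial a′ y))
    reduced-or-divisible []       = inj₁ (here refl)
    reduced-or-divisible (a ∷ as) with a <? d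
    ... | no a≮d with m≤n⇒∃[o]m+o≡n (≮⇒≥ a≮d)
    ...   | b , refl = inj₂ (zero , b ∷ as , +-assoc d b _ ,
      λ { (y ∷ ys) → trans (cong (_⊗ monomial as ys) (pow-+ y d b)) (K.*-assoc _ _ _) })
    reduced-or-divisible (a ∷ as) | yes a<d with reduced-or-divisible as
    ...   | inj₁ as∈ = inj₁ (∈-cartesianProductWith⁺ _∷_ (∈-upTo⁺ a<d) as∈)
    ...   | inj₂ (i , as′ , degree , factor) = inj₂ (suc i , a ∷ as′ ,
      trans (cong (a +_) degree) (shuffle a d _) ,
      λ { (y ∷ ys) → trans (cong (pow y a ⊗_) (factor ys))
            (K.solve 3 (λ u v w → u K.:* (v K.:* w) K.:= v K.:* (u K.:* w)) refl
              (pow y a) (pow (lookup ys i) d) (monomial as′ ys)) })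
      where
      shuffle : ∀ a b c → a + (b + c) ≡ b + (a + c)
      shuffle = solve-∀

    module _ {n r : ℕ} {Y : Point n → Point r} {Z : List (Point n)}
      (relation : ∀ i → ∃ λ G → DegreeAtMost e G ×
                    (∀ {x} → x ∈ Z → pow (lookup (Y x) i) d ≡ eval G (Y x)))
      where

      -- Division with remainder by the relations y_i ^ d = G_i, which hold on Z. Each replacement
      -- lowers the degree of the term, so induction on the degree bound k terminates.
      reduce : ∀ k (p : Poly r) → DegreeAtMost k p →
        ∃ λ p′ → Reduced p′ × (∀ {x} → x ∈ Z → eval p (Y x) ≡ eval p′ (Y x))
      reduce k []            []          = [] , [] , λ _ → refl
      reduce k ((a , c) ∷ p) (a≤k ∷ p≤k) with reduced-or-divisible a | reduce k p p≤k
      ... | inj₁ a∈ | p′ , red , p≡p′ = (a , c) ∷ p′ , a∈ ∷ red , λ x∈Z → cong (_ ⊕_) (p≡p′ x∈Z)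
      -- A term of degree 0 cannot be divisible by y_i ^ d, as d ≥ 1.
      reduce zero ((a , c) ∷ p) (a≤0 ∷ p≤0) | inj₂ (i , a′ , degree , factor) | p′ , red , p≡p′
        with () ← subst (_≤ 0) degree a≤0
      reduce (suc k) ((a , c) ∷ p) (a≤k ∷ p≤k) | inj₂ (i , a′ , degree , factor) | p′ , red , p≡p′
        with relation i
      ... | G , G≤e , yᵢᵈ≡G with subst (_≤ suc k) degree a≤k
      -- From (e + 1) + deg a′ ≤ k + 1 it follows that the product of G with the cofactor has degree
      -- at most k.
      ... | s≤s e+a′≤k with reduce k (termMul (a′ , c) G)
                              (All.map (λ t≤ → ≤-trans t≤ (subst (_≤ k) (+-comm e (totalDegree a′)) e+a′≤k))
                                       (degree-termMul ≤-refl G≤e))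
      ... | p″ , red″ , G≡p″ = p″ ++ p′ , ++⁺ red″ red , λ {x} x∈Z → begin
        c ⊗ monomial a (Y x) ⊕ eval p (Y x)
          ≡⟨ cong (λ t → c ⊗ t ⊕ eval p (Y x)) (factor (Y x)) ⟩
        c ⊗ (pow (lookup (Y x) i) d ⊗ monomial a′ (Y x)) ⊕ eval p (Y x)
          ≡⟨ cong (λ t → c ⊗ (t ⊗ monomial a′ (Y x)) ⊕ eval p (Y x)) (yᵢᵈ≡G x∈Z) ⟩
        c ⊗ (eval G (Y x) ⊗ monomial a′ (Y x)) ⊕ eval p (Y x)
          ≡⟨ cong (_⊕ eval p (Y x)) (K.solve 3 (λ c g u → c K.:* (g K.:* u) K.:= c K.:* u K.:* g) refl
               c (eval G (Y x)) (monomial a′ (Y x))) ⟩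
        c ⊗ monomial a′ (Y x) ⊗ eval G (Y x) ⊕ eval p (Y x)
          ≡⟨ cong₂ _⊕_ (trans (sym (eval-termMul a′ c G (Y x))) (G≡p″ x∈Z)) (p≡p′ x∈Z) ⟩
        eval p″ (Y x) ⊕ eval p′ (Y x)
          ≡⟨ eval-++ p″ p′ (Y x) ⟨
        eval (p″ ++ p′) (Y x) ∎
        where open ≡-Reasoning

    -- A `Poly` may repeat an exponent vector, so coefficients of equal monomials are added up. What
    -- remains is a vector of fixed length d ^ r, which can be counted.
    reduced-coefficients : ∀ {r} (p : Poly r) → Reduced p →
      ∃ λ cs → ∀ y → eval p y ≡ evalLinear cs (map (λ a → monomial a y) (fromList (exponents r)))
    reduced-coefficients []                []         = replicate _ 0# , λ y →
      sym (linear-0 (map (λ a → monomial a y) (fromList (exponents _))))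
    reduced-coefficients {r} ((a , c) ∷ p) (a∈ ∷ red)
      with coefficient-vector (exponents r) a∈ c | reduced-coefficients p red
    ... | cs , eq | cs′ , eq′ = zipWith _⊕_ cs cs′ ,
      λ y → trans (cong₂ _⊕_ (sym (eq (λ a → monomial a y))) (eq′ y)) (sym (linear-+ cs cs′ _))

    -- Since g is existential, a slice h = c qualifies on the same footing as the given
    -- hypersurfaces.
    OnHypersurface : ∀ {n} → LinearForm n → List (Point n) → Set
    OnHypersurface {n} h Z =
      ∃ λ (g : Poly n) → DegreeAtMost e g × (∀ {x} → x ∈ Z → evalHdPlusG h d g x ≡ 0#)

    OnHypersurfaces : ∀ {n r} → Vec (LinearForm n) r → List (Point n) → Set
    OnHypersurfaces L Z = ∀ i → OnHypersurface (lookup L i) Z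

    on-⊆ : ∀ {n} (h : LinearForm n) {Z Z′} → (∀ {x} → x ∈ Z′ → x ∈ Z) →
           OnHypersurface h Z → OnHypersurface h Z′
    on-⊆ h Z′⊆Z (g , g≤e , on) = g , g≤e , λ x∈Z′ → on (Z′⊆Z x∈Z′)

    on-∷ : ∀ {n r} {h : LinearForm n} {L : Vec (LinearForm n) r} {Z} →
           OnHypersurface h Z → OnHypersurfaces L Z → OnHypersurfaces (h ∷ L) Z
    on-∷ on-h on-L zero    = on-h
    on-∷ on-h on-L (suc i) = on-L i

    lookup-values : ∀ {n r} (L : Vec (LinearForm n) r) x i → lookup (values L x) i ≡ evalLinear (lookup L i) x
    lookup-values (ℓ ∷ L) x zero    = refl
    lookup-values (ℓ ∷ L) x (suc i) = lookup-values L x i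

    -- Any values prescribed on Z are interpolated by a polynomial in the forms of L, which reduces
    -- to the d ^ r monomials with exponents below d. Evaluation on Z recovers the values from the
    -- coefficients, so the choice of coefficients is injective and |Z| ≤ d ^ r.
    spanning-bound : ∀ {n r} (L : Vec (LinearForm n) r) → (∀ h → InSpan L h) →
      ∀ {Z} → Unique Z → OnHypersurfaces L Z → length Z ≤ d ^ r
    spanning-bound {n} {r} L spans {Z} uniq on = subst (length Z ≤_) (length-exponents r)
      (injection⇒≤ (λ v → proj₁ (coefficients v))
        (λ {u} {v} eq → trans (sym (proj₂ (coefficients u)))
          (trans (cong (λ cs → map (value cs) (fromList Z)) eq) (proj₂ (coefficients v)))))
      where
      Y : Point n → Point r
      Y = values L

      coordinates : ∀ j → PolynomialIn Y 1 (λ x → lookup x j)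
      -- The coordinate x_j is the value of a unit form, which lies in the span of L.
      coordinates j with spans (replicate n 0# [ j ]≔ 1#)
      ... | c , eq = polynomial-≗
        (λ x → trans (sym (linear-unit j x)) (trans (cong (λ h → evalLinear h x) (sym eq)) (evalLinear-combination L c x)))
        (polynomial-linear c)

      relation : ∀ i → ∃ λ G → DegreeAtMost e G × (∀ {x} → x ∈ Z → pow (lookup (Y x) i) d ≡ eval G (Y x))
      relation i with on i
      ... | g , g≤e , zero-on with polynomial-* (polynomial-const (⊖ 1#)) (polynomial-eval coordinates g g≤e)
      ... | G , G≤e , -g≡G = G , G≤e , λ {x} x∈Z → begin
        pow (lookup (Y x) i) d            ≡⟨ cong (λ t → pow t d) (lookup-values L x i) ⟩
        pow (evalLinear (lookup L i) x) d ≡⟨ K.+-inverseˡ-unique _ _ (zero-on x∈Z) ⟩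
        ⊖ eval g x                        ≡⟨ K.-1*x≈-x _ ⟨
        ⊖ 1# ⊗ eval g x                   ≡⟨ -g≡G x ⟩
        eval G (Y x)                      ∎
        where open ≡-Reasoning

      value : Vec Carrier (length (exponents r)) → Point n → Carrier
      value cs x = evalLinear cs (map (λ a → monomial a (Y x)) (fromList (exponents r)))

      coefficients : (v : Vec Carrier (length Z)) → ∃ λ cs → map (value cs) (fromList Z) ≡ v
      coefficients v with interpolate coordinates Z uniq v
      ... | k , f , (p , p≤k , f≡p) , f≡v with reduce relation k p p≤k
      ... | p′ , red , p≡p′ with reduced-coefficients p′ red
      ... | cs , p′≡cs = cs , trans (agree Z (λ x∈Z → x∈Z)) f≡v
        where
        agree : ∀ W → (∀ {x} → x ∈ W → x ∈ Z) → map (value cs) (fromList W) ≡ map f (fromList W)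
        agree []      _   = refl
        agree (x ∷ W) W⊆Z = cong₂ _∷_
          (trans (sym (p′≡cs (Y x))) (trans (sym (p≡p′ (W⊆Z (here refl)))) (sym (f≡p x))))
          (agree W (W⊆Z ∘ there))

    slices : ∀ {n} (h : LinearForm n) (Z : List (Point n)) →
      length Z ≡ sum (List.map (λ c → length (filter (λ x → evalLinear h x ≟ᶠ c) Z)) carriers)
    slices h Z = begin
      length Z
        ≡⟨ trans (sum-const 1 Z) (*-identityʳ _) ⟨
      sum (List.map (λ _ → 1) Z)
        ≡⟨ sum-cong Z (λ x → once (evalLinear h x) carriers unique-carriers (∈-carriers _)) ⟩
      sum (List.map (λ x → sum (List.map (λ c → 𝟙 (evalLinear h x ≟ᶠ c)) carriers)) Z)
        ≡⟨ sum-swap (λ x c → 𝟙 (evalLinear h x ≟ᶠ c)) Z carriers ⟩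
      sum (List.map (λ c → sum (List.map (λ x → 𝟙 (evalLinear h x ≟ᶠ c)) Z)) carriers)
        ≡⟨ sum-cong carriers (λ c → length-filter-sum (λ x → evalLinear h x ≟ᶠ c) Z) ⟨
      sum (List.map (λ c → length (filter (λ x → evalLinear h x ≟ᶠ c) Z)) carriers) ∎
      where
      open ≡-Reasoning
      never : ∀ a cs → All (a ≢_) cs → 0 ≡ sum (List.map (λ c → 𝟙 (a ≟ᶠ c)) cs)
      never a []       []           = refl
      never a (c ∷ cs) (a≢c ∷ a∉cs) with a ≟ᶠ c
      ... | yes a≡c = contradiction a≡c a≢c
      ... | no _    = never a cs a∉cs
      once : ∀ a cs → Unique cs → a ∈ cs → 1 ≡ sum (List.map (λ c → 𝟙 (a ≟ᶠ c)) cs)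
      once a (c ∷ cs) (c∉cs ∷ uniq) a∈ with a ≟ᶠ c | a∈
      ... | yes refl | _           = cong suc (never a cs c∉cs)
      ... | no a≢c   | here a≡c    = contradiction a≡c a≢c
      ... | no _     | there a∈cs  = once a cs uniq a∈cs

    -- Where h = c, the constant - c ^ d serves as g; its degree 0 is admissible for every e.
    on-slice : ∀ {n} (h : LinearForm n) c (Z : List (Point n)) →
               OnHypersurface h (filter (λ x → evalLinear h x ≟ᶠ c) Z)
    on-slice {n} h c Z with polynomial-const {n} {n} {λ x → x} (⊖ pow c d)
    ... | g , g≤0 , -cᵈ≡g = g , All.map (λ t≤0 → ≤-trans t≤0 z≤n) g≤0 , λ {x} x∈ → begin
      pow (evalLinear h x) d ⊕ eval g x
        ≡⟨ cong₂ _⊕_ (cong (λ t → pow t d) (proj₂ (∈-filter⁻ (λ x → evalLinear h x ≟ᶠ c) {xs = Z} x∈))) (sym (-cᵈ≡g x)) ⟩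
      pow c d ⊕ ⊖ pow c d
        ≡⟨ K.-‿inverseʳ _ ⟩
      0# ∎
      where open ≡-Reasoning

    -- Induction on the number s of forms missing from a basis. A new form h cuts Z into q slices,
    -- and each slice lies on one more hypersurface with an independent leading form, so every
    -- missing form costs a factor q.
    independent-bound : ∀ {n r} s (L : Vec (LinearForm n) r) → s + r ≡ n → Independent L →
      ∀ {Z} → Unique Z → OnHypersurfaces L Z → length Z ≤ d ^ n * q ^ s
    independent-bound {n} {r} s L eq ind {Z} uniq on with extendable-or-spanning L
    ... | inj₂ spans = begin
      length Z       ≤⟨ spanning-bound L spans uniq on ⟩
      d ^ r          ≤⟨ ^-monoʳ-≤ d (subst (r ≤_) eq (m≤n+m r s)) ⟩
      d ^ n          ≤⟨ m≤m*n (d ^ n) (q ^ s) {{m^n≢0 q s {{>-nonZero (≤-trans (s≤s z≤n) 1<q)}}}} ⟩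
      d ^ n * q ^ s  ∎
      where open ≤-Reasoning
    -- There cannot be n + 1 independent forms in n variables.
    independent-bound zero L refl ind uniq on | inj₁ (h , h∉L) =
      contradiction (independent⇒≤ (h ∷ L) (h∉L , ind)) (<⇒≱ ≤-refl)
    independent-bound {n} {r} (suc s) L eq ind {Z} uniq on | inj₁ (h , h∉L) = begin
      length Z
        ≡⟨ slices h Z ⟩
      sum (List.map (λ c → length (slice c)) carriers)
        ≤⟨ sum-mono carriers (λ c → independent-bound s (h ∷ L) (trans (+-suc s r) eq) (h∉L , ind)
             (Unique.filter⁺ _ uniq)
             (on-∷ (on-slice h c Z) (λ i → on-⊆ (lookup L i) (λ x∈ → proj₁ (∈-filter⁻ _ {xs = Z} x∈)) (on i)))) ⟩
      sum (List.map (λ _ → d ^ n * q ^ s) carriers)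
        ≡⟨ trans (sum-const _ carriers) (cong (_* (d ^ n * q ^ s)) length-carriers) ⟩
      q * (d ^ n * q ^ s)
        ≡⟨ shuffle q (d ^ n) (q ^ s) ⟩
      d ^ n * (q * q ^ s) ∎
      where
      open ≤-Reasoning
      slice : Carrier → List (Point n)
      slice c = filter (λ x → evalLinear h x ≟ᶠ c) Z
      shuffle : ∀ a b c → a * (b * c) ≡ b * (a * c)
      shuffle = solve-∀

    -- Averaging over tuples of linear forms.

    module _ {n : ℕ} (g : LinearForm n → Poly n) where

      on? : ∀ h x → Dec (evalHdPlusG h d (g h) x ≡ 0#)
      on? h x = evalHdPlusG h d (g h) x ≟ᶠ 0#

      restrict : LinearForm n → List (Point n) → List (Point n)
      restrict h = filter (on? h)

      restrict-⊆ : ∀ h Z {x} → x ∈ restrict h Z → x ∈ Z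
      restrict-⊆ h Z x∈ = proj₁ (∈-filter⁻ (on? h) {xs = Z} x∈)

      on-restrict : (∀ h → DegreeAtMost e (g h)) → ∀ h Z → OnHypersurface h (restrict h Z)
      on-restrict g≤e h Z = g h , g≤e h , λ x∈ → proj₂ (∈-filter⁻ (on? h) {xs = Z} x∈)

      -- The sum of |Z ∩ Z(h₁) ∩ ⋯ ∩ Z(hₖ)| over all k-tuples of linear forms, Z(h) being the zero set of h^d + g h.
      intersections : ℕ → List (Point n) → ℕ
      intersections zero    Z = length Z
      intersections (suc k) Z = sum (List.map (λ h → intersections k (restrict h Z)) (vectors n))

      multiplicity : Point n → ℕ
      multiplicity x = sum (List.map (λ h → 𝟙 (on? h x)) (vectors n))

      -- Double counting of points together with k-tuples of forms through them. The k choices at a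
      -- point x are independent, so the sum is the k-th moment of `multiplicity`.
      intersections-power : ∀ k Z → intersections k Z ≡ sum (List.map (λ x → multiplicity x ^ k) Z)
      intersections-power zero    Z = sym (trans (sum-const 1 Z) (*-identityʳ _))
      intersections-power (suc k) Z = begin
        sum (List.map (λ h → intersections k (restrict h Z)) (vectors n))
          ≡⟨ sum-cong (vectors n) (λ h → trans (intersections-power k (restrict h Z)) (sum-filter (on? h) _ Z)) ⟩
        sum (List.map (λ h → sum (List.map (λ x → 𝟙 (on? h x) * multiplicity x ^ k) Z)) (vectors n))
          ≡⟨ sum-swap (λ h x → 𝟙 (on? h x) * multiplicity x ^ k) (vectors n) Z ⟩
        sum (List.map (λ x → sum (List.map (λ h → 𝟙 (on? h x) * multiplicity x ^ k) (vectors n))) Z)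
          ≡⟨ sum-cong Z (λ x → sum-*ʳ (λ h → 𝟙 (on? h x)) (multiplicity x ^ k) (vectors n)) ⟩
        sum (List.map (λ x → multiplicity x ^ suc k) Z) ∎
        where open ≡-Reasoning

      -- Each of the (q ^ n) ^ k tuples leaves a subset of Z. This is sharp enough once n
      -- independent forms have been chosen.
      intersections-trivial : ∀ k Z → intersections k Z ≤ length Z * (q ^ n) ^ k
      intersections-trivial zero    Z = ≤-reflexive (sym (*-identityʳ _))
      intersections-trivial (suc k) Z = begin
        sum (List.map (λ h → intersections k (restrict h Z)) (vectors n))
          ≤⟨ sum-mono (vectors n) (λ h → ≤-trans (intersections-trivial k (restrict h Z))
               (*-monoˡ-≤ ((q ^ n) ^ k) (length-filter (on? h) Z))) ⟩
        sum (List.map (λ _ → length Z * (q ^ n) ^ k) (vectors n))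
          ≡⟨ trans (sum-const _ (vectors n)) (cong (_* (length Z * (q ^ n) ^ k)) (length-vectors n)) ⟩
        q ^ n * (length Z * (q ^ n) ^ k)
          ≡⟨ shuffle (q ^ n) (length Z) ((q ^ n) ^ k) ⟩
        length Z * (q ^ n * (q ^ n) ^ k) ∎
        where
        open ≤-Reasoning
        shuffle : ∀ a b c → a * (b * c) ≡ b * (a * c)
        shuffle = solve-∀

    module _ {n′ : ℕ} (g : LinearForm (suc n′) → Poly (suc n′)) (g≤e : ∀ h → DegreeAtMost e (g h)) where

      private
        n : ℕ
        n = suc n′

      -- Up to the factor d^n and normalisation by q^(nk), this is the expected number of common zeros
      -- of k random linear forms in an s-dimensional space, 1 + (q^s − 1) / q^k, written without subtraction.
      intersections-bound : ∀ k s {r} (L : Vec (LinearForm n) r) → s + r ≡ n → Independent L →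
        ∀ {Z} → Unique Z → OnHypersurfaces L Z →
        intersections g k Z + d ^ n * (q ^ n′) ^ k ≤ d ^ n * ((q ^ n) ^ k + q ^ s * (q ^ n′) ^ k)
      intersections-bound zero s L eq ind {Z} uniq on = begin
        length Z + d ^ n * 1             ≤⟨ +-monoˡ-≤ (d ^ n * 1) (independent-bound s L eq ind uniq on) ⟩
        d ^ n * q ^ s + d ^ n * 1        ≡⟨ identity (d ^ n) (q ^ s) ⟩
        d ^ n * (1 + q ^ s * 1)          ∎
        where
        open ≤-Reasoning
        identity : ∀ a b → a * b + a * 1 ≡ a * (1 + b * 1)
        identity = solve-∀
      -- At full rank Z already has at most d ^ n points, and further forms can only remove some.
      intersections-bound k@(suc _) zero L eq ind {Z} uniq on = begin
        intersections g k Z + d ^ n * (q ^ n′) ^ k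
          ≤⟨ +-monoˡ-≤ _ (≤-trans (intersections-trivial g k Z)
               (*-monoˡ-≤ ((q ^ n) ^ k) (independent-bound 0 L eq ind uniq on))) ⟩
        d ^ n * 1 * (q ^ n) ^ k + d ^ n * (q ^ n′) ^ k
          ≡⟨ identity (d ^ n) ((q ^ n) ^ k) ((q ^ n′) ^ k) ⟩
        d ^ n * ((q ^ n) ^ k + 1 * (q ^ n′) ^ k) ∎
        where
        open ≤-Reasoning
        identity : ∀ a b c → a * 1 * b + a * c ≡ a * (b + 1 * c)
        identity = solve-∀
      intersections-bound (suc k) (suc s) {r} L eq ind {Z} uniq on with m≤n⇒∃[o]m+o≡n (≤-trans (s≤s z≤n) 1<q)
      -- The summand added to both sides completes D * (P * c) to q ^ n copies of D * c, one for
      -- each choice of the next form h, as the induction hypothesis demands.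
      ... | q₁ , 1+q₁≡q = +-cancelʳ-≤ (D * (P * q₁ * c)) _ _ (begin
        T + D * (P * c) + D * (P * q₁ * c)
          ≡⟨ split T D P c q₁ ⟩
        T + (1 + q₁) * P * (D * c)
          ≡⟨ cong (λ t → T + t * P * (D * c)) 1+q₁≡q ⟩
        T + q ^ n * (D * c)
          ≡⟨ cong (T +_) (trans (sum-const (D * c) V) (cong (_* (D * c)) (length-vectors n))) ⟨
        T + sum (List.map (λ _ → D * c) V)
          ≡⟨ sum-+ (λ h → t h) (λ _ → D * c) V ⟨
        sum (List.map (λ h → t h + D * c) V)
          ≤⟨ sum-mono V step ⟩
        sum (List.map (λ h → D * ((q ^ n) ^ k + w h * c)) V)
          ≡⟨ sum-*ˡ D (λ h → (q ^ n) ^ k + w h * c) V ⟩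
        D * sum (List.map (λ h → (q ^ n) ^ k + w h * c) V)
          ≡⟨ cong (D *_) (trans (sum-+ (λ _ → (q ^ n) ^ k) (λ h → w h * c) V)
               (cong₂ _+_ (trans (sum-const _ V) (cong (_* (q ^ n) ^ k) (length-vectors n))) (sum-*ʳ w c V))) ⟩
        D * (q ^ n * (q ^ n) ^ k + sum (List.map w V) * c)
          ≤⟨ *-monoʳ-≤ D (+-monoʳ-≤ _ (*-monoˡ-≤ c weights)) ⟩
        D * (q ^ n * (q ^ n) ^ k + (q ^ n * q ^ s + P * q₁) * c)
          ≡⟨ regroup D (q ^ n * (q ^ n) ^ k) q P (q ^ s) q₁ c ⟩
        D * (q ^ n * (q ^ n) ^ k + q * q ^ s * (P * c)) + D * (P * q₁ * c) ∎)
        where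
        open ≤-Reasoning
        D = d ^ n
        P = q ^ n′
        c = (q ^ n′) ^ k
        V = vectors n
        t : LinearForm n → ℕ
        t h = intersections g k (restrict g h Z)
        T = sum (List.map t V)
        w : LinearForm n → ℕ
        -- This is q ^ (s + 1) if h lies in the span of L, where the rank stays, and q ^ s
        -- otherwise, where one missing dimension is used up.
        w h = q ^ s + 𝟙 (inSpan? L h) * (q ^ s * q₁)

        step : ∀ h → t h + D * c ≤ D * ((q ^ n) ^ k + w h * c)
        step h with inSpan? L h
        ... | yes _ = subst (λ u → t h + D * c ≤ D * ((q ^ n) ^ k + u * c))
          (trans (cong (_* q ^ s) (sym 1+q₁≡q)) (identity q₁ (q ^ s)))
          (intersections-bound k (suc s) L eq ind (Unique.filter⁺ _ uniq)
            (λ i → on-⊆ (lookup L i) (restrict-⊆ g h Z) (on i)))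
          where
          identity : ∀ a b → (1 + a) * b ≡ b + 1 * (b * a)
          identity = solve-∀
        ... | no h∉L = subst (λ u → t h + D * c ≤ D * ((q ^ n) ^ k + u * c)) (sym (+-identityʳ (q ^ s)))
          (intersections-bound k s (h ∷ L) (trans (+-suc s r) eq) (h∉L , ind) (Unique.filter⁺ _ uniq)
            (on-∷ (on-restrict g g≤e h Z) (λ i → on-⊆ (lookup L i) (restrict-⊆ g h Z) (on i))))

        weights : sum (List.map w V) ≤ q ^ n * q ^ s + P * q₁
        weights = begin
          sum (List.map w V)
            ≡⟨ sum-+ (λ _ → q ^ s) (λ h → 𝟙 (inSpan? L h) * (q ^ s * q₁)) V ⟩
          sum (List.map (λ _ → q ^ s) V) + sum (List.map (λ h → 𝟙 (inSpan? L h) * (q ^ s * q₁)) V)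
            ≡⟨ cong₂ _+_ (trans (sum-const _ V) (cong (_* q ^ s) (length-vectors n)))
                 (trans (sum-*ʳ _ (q ^ s * q₁) V) (cong (_* (q ^ s * q₁)) (sym (length-filter-sum (inSpan? L) V)))) ⟩
          q ^ n * q ^ s + length (filter (inSpan? L) V) * (q ^ s * q₁)
            ≤⟨ +-monoʳ-≤ _ (*-monoˡ-≤ (q ^ s * q₁) (spanSize L)) ⟩
          q ^ n * q ^ s + q ^ r * (q ^ s * q₁)
            -- Here (s + 1) + r = n, so q ^ s * q ^ r is q ^ n′.
            ≡⟨ cong (q ^ n * q ^ s +_) (trans (assoc (q ^ r) (q ^ s) q₁)
                 (cong (_* q₁) (trans (sym (^-distribˡ-+-* q s r)) (cong (q ^_) (suc-injective eq))))) ⟩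
          q ^ n * q ^ s + P * q₁ ∎
          where
          assoc : ∀ a b c → a * (b * c) ≡ b * a * c
          assoc = solve-∀

        split : ∀ t D P c u → t + D * (P * c) + D * (P * u * c) ≡ t + (1 + u) * P * (D * c)
        split = solve-∀
        regroup : ∀ D a q P b u c → D * (a + (q * P * b + P * u) * c) ≡ D * (a + q * b * (P * c)) + D * (P * u * c)
        regroup = solve-∀

      -- With as many random forms as dimensions, k = s = n, the average 1 + (q ^ n - 1) / q ^ n
      -- stays below 2.
      intersections-total : ∀ {S} → Unique S → intersections g n S ≤ 2 * d ^ n * (q ^ n) ^ n
      intersections-total {S} uniq = begin
        intersections g n S
          ≤⟨ m≤m+n _ _ ⟩
        intersections g n S + d ^ n * (q ^ n′) ^ n
          ≤⟨ intersections-bound n n [] (+-identityʳ n) tt uniq (λ ()) ⟩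
        d ^ n * ((q ^ n) ^ n + q ^ n * (q ^ n′) ^ n)
          ≡⟨ cong (λ t → d ^ n * ((q ^ n) ^ n + t)) (^-distribʳ-* n q (q ^ n′)) ⟨
        d ^ n * ((q ^ n) ^ n + (q ^ n) ^ n)
          ≡⟨ identity (d ^ n) ((q ^ n) ^ n) ⟩
        2 * d ^ n * (q ^ n) ^ n ∎
        where
        open ≤-Reasoning
        identity : ∀ a b → a * (b + b) ≡ 2 * a * b
        identity = solve-∀

      -- The n-th moment of `multiplicity` is squeezed: richness and the power mean bound it from
      -- below, `intersections-total` bounds it from above, and the number (q ^ n) ^ n of tuples
      -- cancels.
      rich⇒large : ∀ m {S} → Unique S → (∀ h → m ≤ richness h d (g h) S) →
                   m ^ n ≤ 2 * d ^ n * length S ^ n′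
      rich⇒large m {S} uniq rich = *-cancelʳ-≤ (m ^ n) _ ((q ^ n) ^ n) {{Qⁿ≢0}} (begin
        m ^ n * (q ^ n) ^ n
          ≡⟨ ^-distribʳ-* n m (q ^ n) ⟨
        (m * q ^ n) ^ n
          ≤⟨ ^-monoˡ-≤ n double-count ⟩
        sum (List.map (multiplicity g) S) ^ n
          ≤⟨ power-mean (multiplicity g) n′ S ⟩
        length S ^ n′ * sum (List.map (λ x → multiplicity g x ^ n) S)
          ≡⟨ cong (length S ^ n′ *_) (intersections-power g n S) ⟨
        length S ^ n′ * intersections g n S
          ≤⟨ *-monoʳ-≤ (length S ^ n′) (intersections-total uniq) ⟩
        length S ^ n′ * (2 * d ^ n * (q ^ n) ^ n)
          ≡⟨ shuffle (length S ^ n′) (2 * d ^ n) ((q ^ n) ^ n) ⟩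
        2 * d ^ n * length S ^ n′ * (q ^ n) ^ n ∎)
        where
        open ≤-Reasoning
        Qⁿ≢0 : NonZero ((q ^ n) ^ n)
        Qⁿ≢0 = m^n≢0 (q ^ n) n {{m^n≢0 q n {{>-nonZero (≤-trans (s≤s z≤n) 1<q)}}}}
        shuffle : ∀ a b c → a * (b * c) ≡ b * a * c
        shuffle = solve-∀
        double-count : m * q ^ n ≤ sum (List.map (multiplicity g) S)
        double-count = begin
          m * q ^ n
            ≡⟨ trans (*-comm m (q ^ n)) (cong (_* m) (sym (length-vectors n))) ⟩
          length (vectors n) * m
            ≡⟨ sum-const m (vectors n) ⟨
          sum (List.map (λ _ → m) (vectors n))
            ≤⟨ sum-mono (vectors n) rich ⟩
          -- The richness of h is by definition the size of `restrict g h S`, so the sum of these is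
          -- the case k = 1.
          intersections g 1 S
            ≡⟨ intersections-power g 1 S ⟩
          sum (List.map (λ x → multiplicity g x ^ 1) S)
            ≡⟨ sum-cong S (λ x → *-identityʳ (multiplicity g x)) ⟩
          sum (List.map (multiplicity g) S) ∎

-- To stay within ℕ, the bound on |S| is raised to the power n - 1 and cleared of denominators.
theorem1p7 : (q : ℕ) → (∃₂ λ p k → Prime p × 1 ≤ k × q ≡ p ^ k) → (F : FiniteField q) →
    (n m d : ℕ) → 2 ≤ n → 1 ≤ m → 1 ≤ d →
    (S : List (FiniteField.Point F n)) → Unique S →
    FiniteField.HyperFurstenberg F m d S →
    m ^ n ≤ d ^ n * (16 * length S) ^ (n ∸ 1)
theorem1p7 q _ F (suc n′) m (suc e) (s≤s 1≤n′) _ _ S uniq rich = begin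
  m ^ n
    ≤⟨ rich⇒large F e (λ h → proj₁ (rich h)) (λ h → proj₁ (proj₂ (rich h))) m uniq (λ h → proj₂ (proj₂ (rich h))) ⟩
  2 * d ^ n * length S ^ n′
    -- The factor 2 is absorbed by 2 ≤ 16 ≤ 16 ^ n′, where n′ ≥ 1 because n ≥ 2.
    ≤⟨ *-monoˡ-≤ (length S ^ n′) (*-monoˡ-≤ (d ^ n) (≤-trans (m≤m+n 2 14) (^-monoʳ-≤ 16 1≤n′))) ⟩
  16 ^ n′ * d ^ n * length S ^ n′
    ≡⟨ shuffle (16 ^ n′) (d ^ n) (length S ^ n′) ⟩
  d ^ n * (16 ^ n′ * length S ^ n′)
    ≡⟨ cong (d ^ n *_) (^-distribʳ-* n′ 16 (length S)) ⟨
  d ^ n * (16 * length S) ^ n′ ∎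
  where
  open ≤-Reasoning
  n = suc n′
  d = suc e
  shuffle : ∀ a b c → a * b * c ≡ b * (a * c)
  shuffle = solve-∀
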